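{- Let $\Gamma$ be a Hintikka set for $\mathbb{T}_1$. Then there exists $\nu\in\mathcal{F}_{C_1}$ such that $\nu(\varphi)=L$ for every signed formula $\mathsf{L}(\varphi)\in\Gamma$ (where the label $\mathsf{T},\mathsf{t},\mathsf{F}$ corresponds to the value $T,t,F$).
   Context: $\Sigma$ has unary $\neg$ and binary $\wedge,\vee,\to$. $\mathcal{A}_{C_1}$ is the $\Sigma$-multialgebra on $\{F,t,T\}$, $D=\{t,T\}$: $F\tilde\vee F=\{F\}$, $F\tilde\vee T=T\tilde\vee F=T\tilde\vee T=\{T\}$, $x\tilde\vee y=D$ if $t\in\{x,y\}$; $x\tilde\wedge y=\{F\}$ if $F\in\{x,y\}$, $T\tilde\wedge T=\{T\}$, $t\tilde\wedge t=t\tilde\wedge T=T\tilde\wedge t=D$; $\tilde\neg F=\{T\}$, $\tilde\neg t=D$, $\tilde\neg T=\{F\}$; $F\tilde\to F=F\tilde\to T=T\tilde\to T=\{T\}$, $t\tilde\to F=T\tilde\to F=\{F\}$, $x\tilde\to t=D$, $t\tilde\to T=D$. Valuations: maps $\nu$ from formulas to $\{F,t,T\}$ with $\nu(\neg\alpha)\in\tilde\neg\nu(\alpha)$, $\nu(\alpha\#\beta)\in\nu(\alpha)\tilde\#\nu(\beta)$; $\mathcal{F}_{C_1}$ = valuations with $\nu(\alpha)=t\Rightarrow\nu(\alpha\wedge\neg\alpha)=T$. Signed formulas are $\mathsf{L}(\varphi)$ with $\mathsf{L}\in\{\mathsf{T},\mathsf{t},\mathsf{F}\}$. A nonempty set $\Gamma$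 of signed formulas is a Hintikka set for $\mathbb{T}_1$ if: (1) $\mathsf{L}(\varphi),\mathsf{L}'(\varphi)\in\Gamma$ imply $\mathsf{L}=\mathsf{L}'$; (2) no $\mathsf{t}(\varphi\wedge\neg\varphi)$ is in $\Gamma$; (3) $\mathsf{T}(\neg\varphi)\in\Gamma\Rightarrow\mathsf{F}(\varphi)\in\Gamma$ or $\mathsf{t}(\varphi)\in\Gamma$; (4) $\mathsf{t}(\neg\varphi)\in\Gamma\Rightarrow\mathsf{t}(\varphi)\in\Gamma$; (5) $\mathsf{F}(\neg\varphi)\in\Gamma\Rightarrow\mathsf{T}(\varphi)\in\Gamma$; (6) $\mathsf{T}(\varphi\wedge\psi)\in\Gamma\Rightarrow$ $\Gamma$ contains $\mathsf{X}(\varphi)$ and $\mathsf{Y}(\psi)$ for some $\mathsf{X},\mathsf{Y}\in\{\mathsf{T},\mathsf{t}\}$; (7) $\mathsf{t}(\varphi\wedge\psi)\in\Gamma\Rightarrow$ $\Gamma$ contains $\mathsf{T}\varphi,\mathsf{t}\psi$, or $\mathsf{t}\varphi,\mathsf{T}\psi$, or $\mathsf{t}\varphi,\mathsf{t}\psi$; (8) $\mathsf{F}(\varphi\wedge\psi)\in\Gamma\Rightarrow\mathsf{F}(\varphi)\in\Gamma$ or $\mathsf{F}(\psi)\in\Gamma$; (9) $\mathsf{T}(\varphi\vee\psi)\in\Gamma\Rightarrow$ one of $\mathsf{T}\varphi,\mathsf{t}\varphi,\mathsf{T}\psi,\mathsf{t}\psi$ is in $\Gamma$; (10) $\mathsf{t}(\varphi\vee\psi)\in\Gamma\Rightarrow\mathsf{t}(\varphi)\in\Gamma$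 or $\mathsf{t}(\psi)\in\Gamma$; (11) $\mathsf{F}(\varphi\vee\psi)\in\Gamma\Rightarrow\mathsf{F}(\varphi),\mathsf{F}(\psi)\in\Gamma$; (12) $\mathsf{T}(\varphi\to\psi)\in\Gamma\Rightarrow$ one of $\mathsf{F}\varphi,\mathsf{T}\psi,\mathsf{t}\psi$ is in $\Gamma$; (13) $\mathsf{t}(\varphi\to\psi)\in\Gamma\Rightarrow$ either $\mathsf{t}\varphi,\mathsf{T}\psi\in\Gamma$ or $\mathsf{t}\psi\in\Gamma$; (14) $\mathsf{F}(\varphi\to\psi)\in\Gamma\Rightarrow$ either $\mathsf{T}\varphi,\mathsf{F}\psi\in\Gamma$ or $\mathsf{t}\varphi,\mathsf{F}\psi\in\Gamma$. -}

module Defs where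

open import Data.Nat using (ℕ)
open import Data.Product using (_×_; ∃₂)
open import Data.Sum using (_⊎_)
open import Level using (Level; 0ℓ)
open import Relation.Binary.PropositionalEquality using (_≡_)
open import Relation.Unary using (Pred; _∈_; _∉_; _∪_; ｛_｝; Satisfiable)

infix  9 ¬̇_
infixr 8 _∧̇_
infixr 7 _∨̇_
infixr 6 _→̇_

data Formula : Set where
  var  : ℕ → Formula
  ¬̇_   : Formula → Formula
  _∧̇_  : Formula → Formula → Formula
  _∨̇_  : Formula → Formula → Formula
  _→̇_  : Formula → Formula → Formula

data Value : Set where
  F t T : Value

D : Pred Value 0ℓ
D = ｛ t ｝ ∪ ｛ T ｝

infix  9 ¬̃_
infixr 8 _∧̃_
infixr 7 _∨̃_
infixr 6 _→̃_

¬̃_ : Value → Pred Value 0ℓ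
¬̃ F = ｛ T ｝
¬̃ t = D
¬̃ T = ｛ F ｝

_∧̃_ : Value → Value → Pred Value 0ℓ
F ∧̃ F = ｛ F ｝
F ∧̃ t = ｛ F ｝
F ∧̃ T = ｛ F ｝
t ∧̃ F = ｛ F ｝
t ∧̃ t = D
t ∧̃ T = D
T ∧̃ F = ｛ F ｝
T ∧̃ t = D
T ∧̃ T = ｛ T ｝

_∨̃_ : Value → Value → Pred Value 0ℓ
F ∨̃ F = ｛ F ｝
F ∨̃ t = D
F ∨̃ T = ｛ T ｝
t ∨̃ F = D
t ∨̃ t = D
t ∨̃ T = D
T ∨̃ F = ｛ T ｝
T ∨̃ t = D
T ∨̃ T = ｛ T ｝

_→̃_ : Value → Value → Pred Value 0ℓ
F →̃ F = ｛ T ｝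
F →̃ t = D
F →̃ T = ｛ T ｝
t →̃ F = ｛ F ｝
t →̃ t = D
t →̃ T = D
T →̃ F = ｛ F ｝
T →̃ t = D
T →̃ T = ｛ T ｝

record IsValuation (ν : Formula → Value) : Set where
  field
    ¬-val : ∀ α   → ν (¬̇ α)   ∈ ¬̃ ν α
    ∧-val : ∀ α β → ν (α ∧̇ β) ∈ ν α ∧̃ ν β
    ∨-val : ∀ α β → ν (α ∨̇ β) ∈ ν α ∨̃ ν β
    →-val : ∀ α β → ν (α →̇ β) ∈ ν α →̃ ν β

record 𝓕C₁ (ν : Formula → Value) : Set where
  field
    isValuation : IsValuation ν
    restriction : ∀ α → ν α ≡ t → ν (α ∧̇ ¬̇ α) ≡ T

data Label : Set where
  𝖳 𝗍 𝖥 : Label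

value : Label → Value
value 𝖳 = T
value 𝗍 = t
value 𝖥 = F

infix 5 _⟨_⟩

record SignedFormula : Set where
  constructor _⟨_⟩
  field
    label   : Label
    formula : Formula

record IsHintikka {ℓ : Level} (Γ : Pred SignedFormula ℓ) : Set ℓ where
  field
    nonempty : Satisfiable Γ
    unique   : ∀ {L L′ φ} → L ⟨ φ ⟩ ∈ Γ → L′ ⟨ φ ⟩ ∈ Γ → L ≡ L′
    no-𝗍∧¬   : ∀ {φ} → 𝗍 ⟨ φ ∧̇ ¬̇ φ ⟩ ∉ Γ
    𝖳¬ : ∀ {φ} → 𝖳 ⟨ ¬̇ φ ⟩ ∈ Γ → 𝖥 ⟨ φ ⟩ ∈ Γ ⊎ 𝗍 ⟨ φ ⟩ ∈ Γ
    𝗍¬ : ∀ {φ} → 𝗍 ⟨ ¬̇ φ ⟩ ∈ Γ → 𝗍 ⟨ φ ⟩ ∈ Γ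
    𝖥¬ : ∀ {φ} → 𝖥 ⟨ ¬̇ φ ⟩ ∈ Γ → 𝖳 ⟨ φ ⟩ ∈ Γ
    𝖳∧ : ∀ {φ ψ} → 𝖳 ⟨ φ ∧̇ ψ ⟩ ∈ Γ →
         ∃₂ λ X Y → X ∈ ｛ 𝖳 ｝ ∪ ｛ 𝗍 ｝ × Y ∈ ｛ 𝖳 ｝ ∪ ｛ 𝗍 ｝
                  × X ⟨ φ ⟩ ∈ Γ × Y ⟨ ψ ⟩ ∈ Γ
    𝗍∧ : ∀ {φ ψ} → 𝗍 ⟨ φ ∧̇ ψ ⟩ ∈ Γ →
         (𝖳 ⟨ φ ⟩ ∈ Γ × 𝗍 ⟨ ψ ⟩ ∈ Γ) ⊎
         (𝗍 ⟨ φ ⟩ ∈ Γ × 𝖳 ⟨ ψ ⟩ ∈ Γ) ⊎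
         (𝗍 ⟨ φ ⟩ ∈ Γ × 𝗍 ⟨ ψ ⟩ ∈ Γ)
    𝖥∧ : ∀ {φ ψ} → 𝖥 ⟨ φ ∧̇ ψ ⟩ ∈ Γ → 𝖥 ⟨ φ ⟩ ∈ Γ ⊎ 𝖥 ⟨ ψ ⟩ ∈ Γ
    𝖳∨ : ∀ {φ ψ} → 𝖳 ⟨ φ ∨̇ ψ ⟩ ∈ Γ →
         𝖳 ⟨ φ ⟩ ∈ Γ ⊎ 𝗍 ⟨ φ ⟩ ∈ Γ ⊎ 𝖳 ⟨ ψ ⟩ ∈ Γ ⊎ 𝗍 ⟨ ψ ⟩ ∈ Γ
    𝗍∨ : ∀ {φ ψ} → 𝗍 ⟨ φ ∨̇ ψ ⟩ ∈ Γ → 𝗍 ⟨ φ ⟩ ∈ Γ ⊎ 𝗍 ⟨ ψ ⟩ ∈ Γ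
    𝖥∨ : ∀ {φ ψ} → 𝖥 ⟨ φ ∨̇ ψ ⟩ ∈ Γ → 𝖥 ⟨ φ ⟩ ∈ Γ × 𝖥 ⟨ ψ ⟩ ∈ Γ
    𝖳→ : ∀ {φ ψ} → 𝖳 ⟨ φ →̇ ψ ⟩ ∈ Γ →
         𝖥 ⟨ φ ⟩ ∈ Γ ⊎ 𝖳 ⟨ ψ ⟩ ∈ Γ ⊎ 𝗍 ⟨ ψ ⟩ ∈ Γ
    𝗍→ : ∀ {φ ψ} → 𝗍 ⟨ φ →̇ ψ ⟩ ∈ Γ →
         (𝗍 ⟨ φ ⟩ ∈ Γ × 𝖳 ⟨ ψ ⟩ ∈ Γ) ⊎ 𝗍 ⟨ ψ ⟩ ∈ Γ
    𝖥→ : ∀ {φ ψ} → 𝖥 ⟨ φ →̇ ψ ⟩ ∈ Γ →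
         (𝖳 ⟨ φ ⟩ ∈ Γ × 𝖥 ⟨ ψ ⟩ ∈ Γ) ⊎ (𝗍 ⟨ φ ⟩ ∈ Γ × 𝖥 ⟨ ψ ⟩ ∈ Γ)

{-# OPTIONS --safe #-}
-- Give every formula signed in Γ the value of its (unique) label, and every other formula a value computed
-- from its immediate subformulas, always resolving the nondeterministic entry D to T. The Hintikka clauses
-- are exactly what makes the signed values legal. Only signed formulas can take the value t, so the
-- restriction on α ∧ ¬ α concerns only α with 𝗍(α) ∈ Γ: there 𝗍(α ∧ ¬ α) is excluded outright,
-- 𝖥(α ∧ ¬ α) would force a second label on α, and an unsigned α ∧ ¬ α has its D resolved to T.
module Submission where

open import Defs
open import Axiom.ExcludedMiddle using (ExcludedMiddle)
open import Data.Product using (_×_; _,_; ∃-syntax)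
open import Data.Sum using (inj₁; inj₂)
open import Level using (Level)
open import Relation.Binary.PropositionalEquality using (_≡_; _≢_; refl; cong)
open import Relation.Nullary using (Dec; yes; no; contradiction)
open import Relation.Unary using (Pred; _∈_)

not : Value → Value
not F = T
not t = T
not T = F

and : Value → Value → Value
and F _ = F
and t F = F
and t t = T
and t T = T
and T F = F
and T t = T
and T T = T

or : Value → Value → Value
or F F = F
or F t = T
or F T = T
or t _ = T
or T _ = T

implies : Value → Value → Value
implies F _ = T
implies t F = F
implies t t = T
implies t T = T
implies T F = F
implies T t = T
implies T T = T

not-∈ : ∀ x → not x ∈ ¬̃ x
not-∈ F = refl
not-∈ t = inj₂ refl
not-∈ T = refl

and-∈ : ∀ x y → and x y ∈ x ∧̃ y
and-∈ F F = refl
and-∈ F t = refl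
and-∈ F T = refl
and-∈ t F = refl
and-∈ t t = inj₂ refl
and-∈ t T = inj₂ refl
and-∈ T F = refl
and-∈ T t = inj₂ refl
and-∈ T T = refl

or-∈ : ∀ x y → or x y ∈ x ∨̃ y
or-∈ F F = refl
or-∈ F t = inj₂ refl
or-∈ F T = refl
or-∈ t F = inj₂ refl
or-∈ t t = inj₂ refl
or-∈ t T = inj₂ refl
or-∈ T F = refl
or-∈ T t = inj₂ refl
or-∈ T T = refl

implies-∈ : ∀ x y → implies x y ∈ x →̃ y
implies-∈ F F = refl
implies-∈ F t = inj₂ refl
implies-∈ F T = refl
implies-∈ t F = refl
implies-∈ t t = inj₂ refl
implies-∈ t T = inj₂ refl
implies-∈ T F = refl
implies-∈ T t = inj₂ refl
implies-∈ T T = refl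

not≢t : ∀ x → not x ≢ t
not≢t F ()
not≢t t ()
not≢t T ()

and≢t : ∀ x y → and x y ≢ t
and≢t F _ ()
and≢t t F ()
and≢t t t ()
and≢t t T ()
and≢t T F ()
and≢t T t ()
and≢t T T ()

or≢t : ∀ x y → or x y ≢ t
or≢t F F ()
or≢t F t ()
or≢t F T ()
or≢t t _ ()
or≢t T _ ()

implies≢t : ∀ x y → implies x y ≢ t
implies≢t F _ ()
implies≢t t F ()
implies≢t t t ()
implies≢t t T ()
implies≢t T F ()
implies≢t T t ()
implies≢t T T ()

-- This group serves the Hintikka clauses that fix the value of only one argument. The tables match
-- on both arguments, so the free one has to be split before an entry reduces.
F∈F∧̃ : ∀ y → F ∈ F ∧̃ y
F∈F∧̃ F = refl
F∈F∧̃ t = refl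
F∈F∧̃ T = refl

F∈∧̃F : ∀ x → F ∈ x ∧̃ F
F∈∧̃F F = refl
F∈∧̃F t = refl
F∈∧̃F T = refl

T∈T∨̃ : ∀ y → T ∈ T ∨̃ y
T∈T∨̃ F = refl
T∈T∨̃ t = inj₂ refl
T∈T∨̃ T = refl

T∈∨̃T : ∀ x → T ∈ x ∨̃ T
T∈∨̃T F = refl
T∈∨̃T t = inj₂ refl
T∈∨̃T T = refl

D⊆t∨̃ : ∀ y {v} → v ∈ D → v ∈ t ∨̃ y
D⊆t∨̃ F v∈D = v∈D
D⊆t∨̃ t v∈D = v∈D
D⊆t∨̃ T v∈D = v∈D

D⊆∨̃t : ∀ x {v} → v ∈ D → v ∈ x ∨̃ t
D⊆∨̃t F v∈D = v∈D
D⊆∨̃t t v∈D = v∈D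
D⊆∨̃t T v∈D = v∈D

T∈F→̃ : ∀ y → T ∈ F →̃ y
T∈F→̃ F = refl
T∈F→̃ t = inj₂ refl
T∈F→̃ T = refl

T∈→̃T : ∀ x → T ∈ x →̃ T
T∈→̃T F = refl
T∈→̃T t = inj₂ refl
T∈→̃T T = refl

D⊆→̃t : ∀ x {v} → v ∈ D → v ∈ x →̃ t
D⊆→̃t F v∈D = v∈D
D⊆→̃t t v∈D = v∈D
D⊆→̃t T v∈D = v∈D

and-t-¬̃t : ∀ {x y} → x ≡ t → y ∈ ¬̃ x → and x y ≡ T
and-t-¬̃t refl (inj₁ refl) = refl
and-t-¬̃t refl (inj₂ refl) = refl

module Induced {ℓ : Level} (em : ExcludedMiddle ℓ) (Γ : Pred SignedFormula ℓ) (hintikka : IsHintikka Γ) where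
  open IsHintikka hintikka

  Signed : Formula → Set ℓ
  Signed φ = ∃[ L ] L ⟨ φ ⟩ ∈ Γ

  select : ∀ {φ} → Dec (Signed φ) → Value → Value
  select (yes (L , _)) _ = value L
  select (no _)        v = v

  -- Membership in `Γ` is an arbitrary predicate, so `em` decides whether a formula is signed. `ν`
  -- calls `default` on the same formula, but `default` calls `ν` only on immediate subformulas, so
  -- the mutual recursion is structural.
  ν       : Formula → Value
  default : Formula → Value

  ν φ = select {φ} em (default φ)

  -- Any value other than `t` would do; `t` would break `default≢t`.
  default (var _)  = T
  default (¬̇ α)   = not (ν α)
  default (α ∧̇ β) = and (ν α) (ν β)
  default (α ∨̇ β) = or (ν α) (ν β)
  default (α →̇ β) = implies (ν α) (ν β)

  -- Isolates the case split on `em`, so that later arguments treat signed and unsigned formulas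
  -- separately without unfolding `ν`.
  ν-elim : ∀ {p} (P : Pred Value p) φ →
           (∀ L → L ⟨ φ ⟩ ∈ Γ → value L ∈ P) → default φ ∈ P → ν φ ∈ P
  ν-elim P φ signed unsigned with em {Signed φ}
  ... | yes (L , Lφ) = signed L Lφ
  ... | no _         = unsigned

  ν-agrees : ∀ L φ → L ⟨ φ ⟩ ∈ Γ → ν φ ≡ value L
  ν-agrees L φ Lφ with em {Signed φ}
  -- The label found by `em` need not be the given `L`; uniqueness identifies them.
  ... | yes (_ , L′φ) = cong value (unique L′φ Lφ)
  ... | no ¬signed    = contradiction (L , Lφ) ¬signed

  default≢t : ∀ φ → default φ ≢ t
  default≢t (var _)  ()
  default≢t (¬̇ α)   = not≢t (ν α)
  default≢t (α ∧̇ β) = and≢t (ν α) (ν β)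
  default≢t (α ∨̇ β) = or≢t (ν α) (ν β)
  default≢t (α →̇ β) = implies≢t (ν α) (ν β)

  ν≡t⇒𝗍∈Γ : ∀ φ → ν φ ≡ t → 𝗍 ⟨ φ ⟩ ∈ Γ
  -- The equation is kept inside the predicate, so each case receives it for its own value.
  ν≡t⇒𝗍∈Γ φ = ν-elim (λ v → v ≡ t → 𝗍 ⟨ φ ⟩ ∈ Γ) φ
    (λ { 𝗍 𝗍φ _ → 𝗍φ ; 𝖳 _ () ; 𝖥 _ () })
    (λ eq → contradiction eq (default≢t φ))

  -- Here and for the binary connectives, the Hintikka clause supplies labels of immediate
  -- subformulas, `ν-agrees` turns them into values, and the table entry is then read off.
  ¬-signed : ∀ α L → L ⟨ ¬̇ α ⟩ ∈ Γ → value L ∈ ¬̃ ν α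
  ¬-signed α 𝖳 m with 𝖳¬ m
  ... | inj₁ p rewrite ν-agrees _ α p = refl
  ... | inj₂ p rewrite ν-agrees _ α p = inj₂ refl
  ¬-signed α 𝗍 m rewrite ν-agrees _ α (𝗍¬ m) = inj₁ refl
  ¬-signed α 𝖥 m rewrite ν-agrees _ α (𝖥¬ m) = refl

  ∧-signed : ∀ α β L → L ⟨ α ∧̇ β ⟩ ∈ Γ → value L ∈ ν α ∧̃ ν β
  ∧-signed α β 𝖳 m with 𝖳∧ m
  ... | _ , _ , inj₁ refl , inj₁ refl , p , q rewrite ν-agrees _ α p | ν-agrees _ β q = refl
  ... | _ , _ , inj₁ refl , inj₂ refl , p , q rewrite ν-agrees _ α p | ν-agrees _ β q = inj₂ refl
  ... | _ , _ , inj₂ refl , inj₁ refl , p , q rewrite ν-agrees _ α p | ν-agrees _ β q = inj₂ refl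
  ... | _ , _ , inj₂ refl , inj₂ refl , p , q rewrite ν-agrees _ α p | ν-agrees _ β q = inj₂ refl
  ∧-signed α β 𝗍 m with 𝗍∧ m
  ... | inj₁ (p , q)        rewrite ν-agrees _ α p | ν-agrees _ β q = inj₁ refl
  ... | inj₂ (inj₁ (p , q)) rewrite ν-agrees _ α p | ν-agrees _ β q = inj₁ refl
  ... | inj₂ (inj₂ (p , q)) rewrite ν-agrees _ α p | ν-agrees _ β q = inj₁ refl
  ∧-signed α β 𝖥 m with 𝖥∧ m
  ... | inj₁ p rewrite ν-agrees _ α p = F∈F∧̃ (ν β)
  ... | inj₂ q rewrite ν-agrees _ β q = F∈∧̃F (ν α)

  ∨-signed : ∀ α β L → L ⟨ α ∨̇ β ⟩ ∈ Γ → value L ∈ ν α ∨̃ ν β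
  ∨-signed α β 𝖳 m with 𝖳∨ m
  ... | inj₁ p               rewrite ν-agrees _ α p = T∈T∨̃ (ν β)
  ... | inj₂ (inj₁ p)        rewrite ν-agrees _ α p = D⊆t∨̃ (ν β) (inj₂ refl)
  ... | inj₂ (inj₂ (inj₁ q)) rewrite ν-agrees _ β q = T∈∨̃T (ν α)
  ... | inj₂ (inj₂ (inj₂ q)) rewrite ν-agrees _ β q = D⊆∨̃t (ν α) (inj₂ refl)
  ∨-signed α β 𝗍 m with 𝗍∨ m
  ... | inj₁ p rewrite ν-agrees _ α p = D⊆t∨̃ (ν β) (inj₁ refl)
  ... | inj₂ q rewrite ν-agrees _ β q = D⊆∨̃t (ν α) (inj₁ refl)
  ∨-signed α β 𝖥 m with 𝖥∨ m
  ... | p , q rewrite ν-agrees _ α p | ν-agrees _ β q = refl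

  →-signed : ∀ α β L → L ⟨ α →̇ β ⟩ ∈ Γ → value L ∈ ν α →̃ ν β
  →-signed α β 𝖳 m with 𝖳→ m
  ... | inj₁ p        rewrite ν-agrees _ α p = T∈F→̃ (ν β)
  ... | inj₂ (inj₁ q) rewrite ν-agrees _ β q = T∈→̃T (ν α)
  ... | inj₂ (inj₂ q) rewrite ν-agrees _ β q = D⊆→̃t (ν α) (inj₂ refl)
  →-signed α β 𝗍 m with 𝗍→ m
  ... | inj₁ (p , q) rewrite ν-agrees _ α p | ν-agrees _ β q = inj₁ refl
  ... | inj₂ q       rewrite ν-agrees _ β q = D⊆→̃t (ν α) (inj₁ refl)
  →-signed α β 𝖥 m with 𝖥→ m
  ... | inj₁ (p , q) rewrite ν-agrees _ α p | ν-agrees _ β q = refl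
  ... | inj₂ (p , q) rewrite ν-agrees _ α p | ν-agrees _ β q = refl

  ν-isValuation : IsValuation ν
  ν-isValuation = record
    { ¬-val = λ α   → ν-elim (¬̃ ν α) (¬̇ α) (¬-signed α) (not-∈ (ν α))
    ; ∧-val = λ α β → ν-elim (ν α ∧̃ ν β) (α ∧̇ β) (∧-signed α β) (and-∈ (ν α) (ν β))
    ; ∨-val = λ α β → ν-elim (ν α ∨̃ ν β) (α ∨̇ β) (∨-signed α β) (or-∈ (ν α) (ν β))
    ; →-val = λ α β → ν-elim (ν α →̃ ν β) (α →̇ β) (→-signed α β) (implies-∈ (ν α) (ν β))
    }

  𝗍∈Γ⇒∧¬-𝖳 : ∀ {α} → 𝗍 ⟨ α ⟩ ∈ Γ → ∀ L → L ⟨ α ∧̇ ¬̇ α ⟩ ∈ Γ → value L ≡ T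
  𝗍∈Γ⇒∧¬-𝖳 𝗍α 𝖳 m = refl
  𝗍∈Γ⇒∧¬-𝖳 𝗍α 𝗍 m = contradiction m no-𝗍∧¬
  𝗍∈Γ⇒∧¬-𝖳 𝗍α 𝖥 m with 𝖥∧ m
  ... | inj₁ 𝖥α  = contradiction (unique 𝗍α 𝖥α) λ ()
  -- `𝖥¬` turns the label of the negation into `𝖳` on `α`, which clashes with `𝗍`.
  ... | inj₂ 𝖥¬α = contradiction (unique 𝗍α (𝖥¬ 𝖥¬α)) λ ()

  ν-restriction : ∀ α → ν α ≡ t → ν (α ∧̇ ¬̇ α) ≡ T
  ν-restriction α να≡t = ν-elim (_≡ T) (α ∧̇ ¬̇ α)
    (𝗍∈Γ⇒∧¬-𝖳 (ν≡t⇒𝗍∈Γ α να≡t))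
    -- `¬̇ α` may itself be signed, so `ν (¬̇ α)` is known only to lie in `D`; `and t` sends both
    -- elements of `D` to `T`.
    (and-t-¬̃t να≡t (IsValuation.¬-val ν-isValuation α))

mainTheorem16 : {ℓ : Level} → ExcludedMiddle ℓ →
    (Γ : Pred SignedFormula ℓ) → IsHintikka Γ →
    ∃[ ν ] (ν ∈ 𝓕C₁ × (∀ L φ → L ⟨ φ ⟩ ∈ Γ → ν φ ≡ value L))
mainTheorem16 em Γ hintikka =
  ν , record { isValuation = ν-isValuation ; restriction = ν-restriction } , ν-agrees
  where open Induced em Γ hintikka
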